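{- Let $p$ be a prime and for $n\ge 0$ let $$H_n(x_1,\dots,x_{n+1})=\prod_{i=1}^n(1+x_i+x_{i+1}),$$ regarded as a polynomial over $\mathbb{F}_p$. Let $N(H_n)$ be the number of nonzero coefficients of $H_n$ (as a polynomial over $\mathbb{F}_p$). Then $$\sum_{n=0}^{\infty}N(H_n)z^n=\frac{1-z^p}{(1-z)^2-z(1-z^p)}.$$
   Context: The empty product is $1$, so $H_0=1$. The identity is one of formal power series in $z$. -}

module Defs where

open import Algebra.Bundles using (RawRing; RawSemiring)
import Algebra.Definitions
import Algebra.Definitions.RawMonoid
import Algebra.Definitions.RawSemiring
open import Data.Fin.Base using (Fin; zero; suc; toℕ; inject₁)
import Data.Fin.Properties as Fin
open import Data.Integer.Base as ℤ using (ℤ; +_; 0ℤ; 1ℤ)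
open import Data.List.Base using (List; []; _∷_; map)
open import Data.Nat.Base as ℕ using (ℕ; zero; suc; NonZero)
open import Data.Nat.ListAction using (sum)
open import Data.Nat.DivMod using (_mod_)
open import Data.Product.Base using (Σ-syntax; _,_)
open import Level using (0ℓ)
open import Relation.Binary.PropositionalEquality using (_≡_)
open import Relation.Nullary.Decidable.Core using (yes; no)

𝔽 : (p : ℕ) .{{_ : NonZero p}} → RawSemiring 0ℓ 0ℓ
𝔽 p = record
  { Carrier = Fin p
  ; _≈_     = _≡_
  ; _+_     = λ a b → (toℕ a ℕ.+ toℕ b) mod p
  ; _*_     = λ a b → (toℕ a ℕ.* toℕ b) mod p
  ; 0#      = 0 mod p
  ; 1#      = 1 mod p
  }

-- Polynomials in one variable: lists of coefficients, constant coefficient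
-- first.  Trailing zeros are allowed, so equality is coefficientwise.
module Univariate {c ℓ} (R : RawSemiring c ℓ) where
  open RawSemiring R

  coeff : List Carrier → ℕ → Carrier
  coeff []      _       = 0#
  coeff (a ∷ _) zero    = a
  coeff (_ ∷ f) (suc k) = coeff f k

  infixl 6 _⊕_
  infixl 7 _⊛_

  _⊕_ : List Carrier → List Carrier → List Carrier
  []      ⊕ g       = g
  (a ∷ f) ⊕ []      = a ∷ f
  (a ∷ f) ⊕ (b ∷ g) = (a + b) ∷ (f ⊕ g)

  _⊛_ : List Carrier → List Carrier → List Carrier
  []      ⊛ g = []
  (a ∷ f) ⊛ g = map (a *_) g ⊕ (0# ∷ (f ⊛ g))

_[X] : ∀ {c ℓ} → RawSemiring c ℓ → RawSemiring c ℓ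
R [X] = record
  { Carrier = List Carrier
  ; _≈_     = λ f g → ∀ k → coeff f k ≈ coeff g k
  ; _+_     = _⊕_
  ; _*_     = _⊛_
  ; 0#      = []
  ; 1#      = 1# ∷ []
  }
  where
  open RawSemiring R
  open Univariate R

-- K [X₁⋯X m ] is K[x_m]⋯[x₂][x₁]: the outermost lists are graded by x₁.
_[X₁⋯X_] : ∀ {c ℓ} → RawSemiring c ℓ → ℕ → RawSemiring c ℓ
K [X₁⋯X zero ]  = K
K [X₁⋯X suc m ] = (K [X₁⋯X m ]) [X]

module _ {c ℓ} (K : RawSemiring c ℓ) where

  -- x i is the variable with 1-based index suc (toℕ i).
  x : ∀ {m} → Fin m → RawSemiring.Carrier (K [X₁⋯X m ])
  x {suc m} zero    = 0# ∷ 1# ∷ []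
    where open RawSemiring (K [X₁⋯X m ])
  x {suc m} (suc i) = x i ∷ []

  H : ∀ n → RawSemiring.Carrier (K [X₁⋯X suc n ])
  H n = product {n} (λ i → 1# + x (inject₁ i) + x (suc i))
    where
    open RawSemiring (K [X₁⋯X suc n ])
    open Algebra.Definitions.RawSemiring (K [X₁⋯X suc n ]) using (product)

-- The number of nonzero coefficients: every monomial up to the stored degrees
-- corresponds to exactly one innermost entry, so zero padding is harmless.
N : ∀ p .{{_ : NonZero p}} m → RawSemiring.Carrier (𝔽 p [X₁⋯X m ]) → ℕ
N p zero a with a Fin.≟ RawSemiring.0# (𝔽 p)
... | yes _ = 0
... | no  _ = 1
N p (suc m) f = sum (map (N p m) f)

ℤ⟦z⟧ : RawRing 0ℓ 0ℓ
ℤ⟦z⟧ = record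
  { Carrier = ℕ → ℤ
  ; _≈_     = λ f g → ∀ n → f n ≡ g n
  ; _+_     = λ f g n → f n ℤ.+ g n
  ; _*_     = λ f g n → Σℤ {suc n} (λ i → f (toℕ i) ℤ.* g (n ℕ.∸ toℕ i))
  ; -_      = λ f n → ℤ.- f n
  ; 0#      = λ _ → 0ℤ
  ; 1#      = λ { zero → 1ℤ ; (suc _) → 0ℤ }
  }
  where open Algebra.Definitions.RawMonoid ℤ.+-0-rawMonoid using () renaming (sum to Σℤ)

module PowerSeries where
  open RawRing ℤ⟦z⟧ public using (Carrier; _≈_; _+_; _*_; -_; 0#; 1#)
  open Algebra.Definitions.RawSemiring (RawRing.rawSemiring ℤ⟦z⟧) public using (_^_)
  open Algebra.Definitions _≈_ using (Invertible)

  infixl 6 _-_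
  infix  4 _≈_/_

  _-_ : Carrier → Carrier → Carrier
  f - g = f + (- g)

  z : Carrier
  z (suc zero) = 1ℤ
  z _          = 0ℤ

  -- h is a unit and f = g h⁻¹; inverses being unique, this determines f.
  _≈_/_ : Carrier → Carrier → Carrier → Set
  f ≈ g / h = Σ[ (h⁻¹ , _) ∈ Invertible 1# _*_ h ] f ≈ g * h⁻¹

module Submission where

open import Defs
open import Algebra.Bundles using (RawSemiring; Semiring; CommutativeRing)
import Algebra.Definitions.RawSemiring
import Algebra.Properties.CommutativeSemigroup
import Algebra.Solver.Ring
open import Algebra.Solver.Ring.AlmostCommutativeRing
  using (fromCommutativeRing; _-Raw-AlmostCommutative⟶_)
open import Algebra.Structures using (IsSemiring; module IsCommutativeSemiring)
import Algebra.Structures.Biased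
open import Data.Fin.Base using (Fin; zero; suc; toℕ; inject₁)
import Data.Fin.Properties as Fin
open import Data.Integer.Base as ℤ using (ℤ; +_; 0ℤ; 1ℤ)
import Data.Integer.Properties as ℤ
open import Data.Integer.Tactic.RingSolver using (solve-∀)
open import Data.List.Base using (List; []; _∷_; map)
open import Data.Maybe.Base as Maybe using (Maybe)
open import Data.Nat.Base as ℕ using (ℕ; zero; suc; NonZero; _<_)
open import Data.Nat.Divisibility using (_∣_; m%n≡0⇒n∣m; n∣m⇒m%n≡0)
open import Data.Nat.DivMod
  using (_%_; _mod_; m<n⇒m%n≡m; n%n≡0; %-distribˡ-+; %-distribˡ-*)
open import Data.Nat.Primality using (Prime; euclidsLemma; prime⇒nonTrivial)
import Data.Nat.Properties as ℕ
open import Data.Product.Base using (_,_)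
open import Data.Sum.Base as Sum using (_⊎_; [_,_]′)
open import Data.Vec.Functional using (Vector)
open import Function.Base using (_∘_)
open import Level using (0ℓ)
import Relation.Binary.Reasoning.Setoid
open import Relation.Binary.PropositionalEquality
  using (_≡_; _≢_; refl; sym; trans; cong; cong₂; isEquivalence; module ≡-Reasoning)
open import Relation.Nullary.Decidable using (yes; no; dec⇒maybe)
open import Relation.Nullary.Negation using (contradiction)

-- Besides a(n) = N(Hₙ), count b_c(n) = N((c + x₁) Hₙ) for c in 𝔽_p.  Since
-- Hₙ₊₁(x₁, …) = (1 + x₂) Hₙ(x₂, …) + x₁ Hₙ(x₂, …), the coefficients of x₁⁰, x₁¹, x₁²
-- in (c + x₁) Hₙ₊₁ are c (1 + x₂) Hₙ, (c + 1 + x₂) Hₙ and Hₙ.  Scaling by c ≠ 0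
-- preserves N, so
--   a(n+1) = a(n) + b₁(n),  b_c(n+1) = a(n+1) + b_{c+1}(n) for 0 < c < p,  b_p = a.
-- The generating functions therefore satisfy A = 1 + z (A + B₁),
-- B_c = 1 + A + z B_{c+1} and B_p = A; eliminating the B_c leaves
-- A ((1 − z)² − z (1 − z^p)) = 1 − z^p.

-- The semiring of polynomials in one variable over a semiring.

SemiringLaws : ∀ {c ℓ} → RawSemiring c ℓ → Set _
SemiringLaws R = IsSemiring _≈_ _+_ _*_ 0# 1#
  where open RawSemiring R

module Polynomial {c ℓ} (R : RawSemiring c ℓ) (laws : SemiringLaws R) where
  open RawSemiring R
  open IsSemiring laws hiding (zero)
    renaming (refl to ≈-refl; sym to ≈-sym; trans to ≈-trans)
  open Univariate R
  open RawSemiring (R [X]) using () renaming (_≈_ to _≋_; 1# to 1ᴾ)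

  semiring : Semiring c ℓ
  semiring = record { isSemiring = laws }

  open Algebra.Properties.CommutativeSemigroup
    (Semiring.+-commutativeSemigroup semiring) using (interchange)
  open Relation.Binary.Reasoning.Setoid setoid

  -- The lists are explicit here and below because `_≋_` unfolds to a statement about `coeff`, from
  -- which they cannot be inferred.
  ∷-cong : ∀ {a b} f g → a ≈ b → f ≋ g → (a ∷ f) ≋ (b ∷ g)
  ∷-cong f g a≈b f≋g zero    = a≈b
  ∷-cong f g a≈b f≋g (suc k) = f≋g k

  coeff-⊕ : ∀ f g k → coeff (f ⊕ g) k ≈ coeff f k + coeff g k
  coeff-⊕ []      g       k       = ≈-sym (+-identityˡ _)
  coeff-⊕ (a ∷ f) []      k       = ≈-sym (+-identityʳ _)
  coeff-⊕ (a ∷ f) (b ∷ g) zero    = ≈-refl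
  coeff-⊕ (a ∷ f) (b ∷ g) (suc k) = coeff-⊕ f g k

  coeff-map : ∀ a f k → coeff (map (a *_) f) k ≈ a * coeff f k
  coeff-map a []      k       = ≈-sym (zeroʳ a)
  coeff-map a (b ∷ f) zero    = ≈-refl
  coeff-map a (b ∷ f) (suc k) = coeff-map a f k

  coeff-⊛ : ∀ a f g k →
    coeff ((a ∷ f) ⊛ g) k ≈ a * coeff g k + coeff (0# ∷ f ⊛ g) k
  coeff-⊛ a f g k =
    ≈-trans (coeff-⊕ (map (a *_) g) (0# ∷ f ⊛ g) k) (+-congʳ (coeff-map a g k))

  -- Prepending `0#` multiplies by X; this carries the induction hypotheses of both distributive
  -- laws through that shift.
  shift-+ : ∀ f g h → (∀ k → coeff h k ≈ coeff f k + coeff g k) →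
    ∀ k → coeff (0# ∷ h) k ≈ coeff (0# ∷ f) k + coeff (0# ∷ g) k
  shift-+ f g h eq zero    = ≈-sym (+-identityˡ 0#)
  shift-+ f g h eq (suc k) = eq k

  ⊕-cong : ∀ f f′ g g′ → f ≋ f′ → g ≋ g′ → (f ⊕ g) ≋ (f′ ⊕ g′)
  ⊕-cong f f′ g g′ p q k = begin
    coeff (f ⊕ g) k         ≈⟨ coeff-⊕ f g k ⟩
    coeff f k + coeff g k   ≈⟨ +-cong (p k) (q k) ⟩
    coeff f′ k + coeff g′ k ≈⟨ coeff-⊕ f′ g′ k ⟨
    coeff (f′ ⊕ g′) k       ∎

  ⊕-assoc : ∀ f g h → ((f ⊕ g) ⊕ h) ≋ (f ⊕ (g ⊕ h))
  ⊕-assoc f g h k = begin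
    coeff ((f ⊕ g) ⊕ h) k               ≈⟨ coeff-⊕ (f ⊕ g) h k ⟩
    coeff (f ⊕ g) k + coeff h k         ≈⟨ +-congʳ (coeff-⊕ f g k) ⟩
    coeff f k + coeff g k + coeff h k   ≈⟨ +-assoc _ _ _ ⟩
    coeff f k + (coeff g k + coeff h k) ≈⟨ +-congˡ (coeff-⊕ g h k) ⟨
    coeff f k + coeff (g ⊕ h) k         ≈⟨ coeff-⊕ f (g ⊕ h) k ⟨
    coeff (f ⊕ (g ⊕ h)) k               ∎

  ⊕-comm : ∀ f g → (f ⊕ g) ≋ (g ⊕ f)
  ⊕-comm f g k = begin
    coeff (f ⊕ g) k       ≈⟨ coeff-⊕ f g k ⟩
    coeff f k + coeff g k ≈⟨ +-comm _ _ ⟩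
    coeff g k + coeff f k ≈⟨ coeff-⊕ g f k ⟨
    coeff (g ⊕ f) k       ∎

  ⊕-identityʳ : ∀ f → (f ⊕ []) ≋ f
  ⊕-identityʳ []      k = ≈-refl
  ⊕-identityʳ (a ∷ f) k = ≈-refl

  -- A zero polynomial may be a nonempty list of zeros, hence the induction. It settles the cases of
  -- `⊛-cong` in which a left factor is the empty list.
  ⊛-zero-cong : ∀ f g → f ≋ [] → (f ⊛ g) ≋ []
  ⊛-zero-cong []      g p k = ≈-refl
  ⊛-zero-cong (a ∷ f) g p k = begin
    coeff ((a ∷ f) ⊛ g) k                 ≈⟨ coeff-⊛ a f g k ⟩
    a * coeff g k + coeff (0# ∷ f ⊛ g) k  ≈⟨ +-cong (*-congʳ (p 0)) (shift≋0 k) ⟩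
    0# * coeff g k + 0#                   ≈⟨ +-identityʳ _ ⟩
    0# * coeff g k                        ≈⟨ zeroˡ _ ⟩
    0#                                    ∎
    where
    shift≋0 : (0# ∷ f ⊛ g) ≋ []
    shift≋0 zero    = ≈-refl
    shift≋0 (suc j) = ⊛-zero-cong f g (λ i → p (suc i)) j

  ⊛-cong : ∀ f f′ g g′ → f ≋ f′ → g ≋ g′ → (f ⊛ g) ≋ (f′ ⊛ g′)
  ⊛-cong []      f′       g g′ p q k = ≈-sym (⊛-zero-cong f′ g′ (λ i → ≈-sym (p i)) k)
  ⊛-cong (a ∷ f) []       g g′ p q k = ⊛-zero-cong (a ∷ f) g p k
  ⊛-cong (a ∷ f) (b ∷ f′) g g′ p q k = begin
    coeff ((a ∷ f) ⊛ g) k                   ≈⟨ coeff-⊛ a f g k ⟩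
    a * coeff g k + coeff (0# ∷ f ⊛ g) k
      ≈⟨ +-cong (*-cong (p 0) (q k)) (∷-cong (f ⊛ g) (f′ ⊛ g′) ≈-refl ih k) ⟩
    b * coeff g′ k + coeff (0# ∷ f′ ⊛ g′) k ≈⟨ coeff-⊛ b f′ g′ k ⟨
    coeff ((b ∷ f′) ⊛ g′) k                 ∎
    where
    ih : (f ⊛ g) ≋ (f′ ⊛ g′)
    ih = ⊛-cong f f′ g g′ (λ i → p (suc i)) q

  ⊛-distribʳ : ∀ h f g → ((f ⊕ g) ⊛ h) ≋ (f ⊛ h ⊕ g ⊛ h)
  ⊛-distribʳ h []      g       k = ≈-refl
  ⊛-distribʳ h (a ∷ f) []      k = ≈-sym (⊕-identityʳ ((a ∷ f) ⊛ h) k)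
  ⊛-distribʳ h (a ∷ f) (b ∷ g) k = begin
    coeff ((a + b ∷ f ⊕ g) ⊛ h) k
      ≈⟨ coeff-⊛ (a + b) (f ⊕ g) h k ⟩
    (a + b) * coeff h k + coeff (0# ∷ (f ⊕ g) ⊛ h) k
      ≈⟨ +-cong (distribʳ _ _ _) (shift-+ (f ⊛ h) (g ⊛ h) _ ih k) ⟩
    (a * coeff h k + b * coeff h k) + (coeff (0# ∷ f ⊛ h) k + coeff (0# ∷ g ⊛ h) k)
      ≈⟨ interchange _ _ _ _ ⟩
    (a * coeff h k + coeff (0# ∷ f ⊛ h) k) + (b * coeff h k + coeff (0# ∷ g ⊛ h) k)
      ≈⟨ +-cong (coeff-⊛ a f h k) (coeff-⊛ b g h k) ⟨
    coeff ((a ∷ f) ⊛ h) k + coeff ((b ∷ g) ⊛ h) k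
      ≈⟨ coeff-⊕ ((a ∷ f) ⊛ h) ((b ∷ g) ⊛ h) k ⟨
    coeff ((a ∷ f) ⊛ h ⊕ (b ∷ g) ⊛ h) k ∎
    where
    ih : ∀ j → coeff ((f ⊕ g) ⊛ h) j ≈ coeff (f ⊛ h) j + coeff (g ⊛ h) j
    ih j = ≈-trans (⊛-distribʳ h f g j) (coeff-⊕ (f ⊛ h) (g ⊛ h) j)

  ⊛-distribˡ : ∀ f g h → (f ⊛ (g ⊕ h)) ≋ (f ⊛ g ⊕ f ⊛ h)
  ⊛-distribˡ []      g h k = ≈-refl
  ⊛-distribˡ (a ∷ f) g h k = begin
    coeff ((a ∷ f) ⊛ (g ⊕ h)) k
      ≈⟨ coeff-⊛ a f (g ⊕ h) k ⟩
    a * coeff (g ⊕ h) k + coeff (0# ∷ f ⊛ (g ⊕ h)) k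
      ≈⟨ +-cong (≈-trans (*-congˡ (coeff-⊕ g h k)) (distribˡ _ _ _)) (shift-+ (f ⊛ g) (f ⊛ h) _ ih k) ⟩
    (a * coeff g k + a * coeff h k) + (coeff (0# ∷ f ⊛ g) k + coeff (0# ∷ f ⊛ h) k)
      ≈⟨ interchange _ _ _ _ ⟩
    (a * coeff g k + coeff (0# ∷ f ⊛ g) k) + (a * coeff h k + coeff (0# ∷ f ⊛ h) k)
      ≈⟨ +-cong (coeff-⊛ a f g k) (coeff-⊛ a f h k) ⟨
    coeff ((a ∷ f) ⊛ g) k + coeff ((a ∷ f) ⊛ h) k
      ≈⟨ coeff-⊕ ((a ∷ f) ⊛ g) ((a ∷ f) ⊛ h) k ⟨
    coeff ((a ∷ f) ⊛ g ⊕ (a ∷ f) ⊛ h) k ∎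
    where
    ih : ∀ j → coeff (f ⊛ (g ⊕ h)) j ≈ coeff (f ⊛ g) j + coeff (f ⊛ h) j
    ih j = ≈-trans (⊛-distribˡ f g h j) (coeff-⊕ (f ⊛ g) (f ⊛ h) j)

  shift-⊛ : ∀ f g → ((0# ∷ f) ⊛ g) ≋ (0# ∷ f ⊛ g)
  shift-⊛ f g k = begin
    coeff ((0# ∷ f) ⊛ g) k                ≈⟨ coeff-⊛ 0# f g k ⟩
    0# * coeff g k + coeff (0# ∷ f ⊛ g) k ≈⟨ +-congʳ (zeroˡ _) ⟩
    0# + coeff (0# ∷ f ⊛ g) k             ≈⟨ +-identityˡ _ ⟩
    coeff (0# ∷ f ⊛ g) k                  ∎

  map-⊛ : ∀ a f g k → coeff (map (a *_) f ⊛ g) k ≈ a * coeff (f ⊛ g) k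
  map-⊛ a []      g k = ≈-sym (zeroʳ a)
  map-⊛ a (b ∷ f) g k = begin
    coeff ((a * b ∷ map (a *_) f) ⊛ g) k
      ≈⟨ coeff-⊛ (a * b) (map (a *_) f) g k ⟩
    a * b * coeff g k + coeff (0# ∷ map (a *_) f ⊛ g) k
      ≈⟨ +-cong (*-assoc _ _ _) (ih k) ⟩
    a * (b * coeff g k) + a * coeff (0# ∷ f ⊛ g) k
      ≈⟨ distribˡ _ _ _ ⟨
    a * (b * coeff g k + coeff (0# ∷ f ⊛ g) k)
      ≈⟨ *-congˡ (coeff-⊛ b f g k) ⟨
    a * coeff ((b ∷ f) ⊛ g) k ∎
    where
    ih : ∀ j → coeff (0# ∷ map (a *_) f ⊛ g) j ≈ a * coeff (0# ∷ f ⊛ g) j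
    ih zero    = ≈-sym (zeroʳ a)
    ih (suc j) = map-⊛ a f g j

  -- Since a + X f acts on g as a g + X (f g), distributivity reduces the claim to scalars (`map-⊛`)
  -- and shifts (`shift-⊛`).
  ⊛-assoc : ∀ f g h → ((f ⊛ g) ⊛ h) ≋ (f ⊛ (g ⊛ h))
  ⊛-assoc []      g h k = ≈-refl
  ⊛-assoc (a ∷ f) g h k = begin
    coeff ((map (a *_) g ⊕ (0# ∷ f ⊛ g)) ⊛ h) k
      ≈⟨ ⊛-distribʳ h (map (a *_) g) (0# ∷ f ⊛ g) k ⟩
    coeff (map (a *_) g ⊛ h ⊕ (0# ∷ f ⊛ g) ⊛ h) k
      ≈⟨ coeff-⊕ (map (a *_) g ⊛ h) ((0# ∷ f ⊛ g) ⊛ h) k ⟩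
    coeff (map (a *_) g ⊛ h) k + coeff ((0# ∷ f ⊛ g) ⊛ h) k
      ≈⟨ +-cong (map-⊛ a g h k) (shift-⊛ (f ⊛ g) h k) ⟩
    a * coeff (g ⊛ h) k + coeff (0# ∷ (f ⊛ g) ⊛ h) k
      ≈⟨ +-congˡ (∷-cong ((f ⊛ g) ⊛ h) (f ⊛ (g ⊛ h)) ≈-refl (⊛-assoc f g h) k) ⟩
    a * coeff (g ⊛ h) k + coeff (0# ∷ f ⊛ (g ⊛ h)) k
      ≈⟨ coeff-⊛ a f (g ⊛ h) k ⟨
    coeff ((a ∷ f) ⊛ (g ⊛ h)) k ∎

  ⊛-zeroʳ : ∀ f → (f ⊛ []) ≋ []
  ⊛-zeroʳ []      k       = ≈-refl
  ⊛-zeroʳ (a ∷ f) zero    = ≈-refl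
  ⊛-zeroʳ (a ∷ f) (suc k) = ⊛-zeroʳ f k

  const-⊛ : ∀ a f k → coeff ((a ∷ []) ⊛ f) k ≈ a * coeff f k
  const-⊛ a f k = begin
    coeff ((a ∷ []) ⊛ f) k                 ≈⟨ coeff-⊛ a [] f k ⟩
    a * coeff f k + coeff (0# ∷ []) k      ≈⟨ +-congˡ (shift-[] k) ⟩
    a * coeff f k + 0#                     ≈⟨ +-identityʳ _ ⟩
    a * coeff f k                          ∎
    where
    shift-[] : (0# ∷ []) ≋ []
    shift-[] zero    = ≈-refl
    shift-[] (suc j) = ≈-refl

  ⊛-identityˡ : ∀ f → (1ᴾ ⊛ f) ≋ f
  ⊛-identityˡ f k = ≈-trans (const-⊛ 1# f k) (*-identityˡ _)

  ⊛-identityʳ : ∀ f → (f ⊛ 1ᴾ) ≋ f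
  ⊛-identityʳ []      k       = ≈-refl
  ⊛-identityʳ (a ∷ f) zero    = ≈-trans (+-identityʳ _) (*-identityʳ a)
  ⊛-identityʳ (a ∷ f) (suc k) = ⊛-identityʳ f k

  polynomialLaws : SemiringLaws (R [X])
  polynomialLaws = record
    { isSemiringWithoutAnnihilatingZero = record
      { +-isCommutativeMonoid = record
        { isMonoid = record
          { isSemigroup = record
            { isMagma = record
              { isEquivalence = record
                { refl  = λ _ → ≈-refl
                ; sym   = λ p k → ≈-sym (p k)
                ; trans = λ p q k → ≈-trans (p k) (q k)
                }
              ; ∙-cong = λ {f} {f′} {g} {g′} → ⊕-cong f f′ g g′
              }
            ; assoc = ⊕-assoc
            }
          ; identity = (λ f k → ≈-refl) , ⊕-identityʳ
          }
        ; comm = ⊕-comm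
        }
      ; *-cong     = λ {f} {f′} {g} {g′} → ⊛-cong f f′ g g′
      ; *-assoc    = ⊛-assoc
      ; *-identity = ⊛-identityˡ , ⊛-identityʳ
      ; distrib    = ⊛-distribˡ , ⊛-distribʳ
      }
    ; zero = (λ f k → ≈-refl) , ⊛-zeroʳ
    }

  -- Products with linear factors in the outermost variable.

  module Coefficients = Algebra.Definitions.RawSemiring R
  module Polynomials  = Algebra.Definitions.RawSemiring (R [X])

  -- Meant for the factors of the next `H` that do not involve x₁: being constant in the outermost
  -- variable, they multiply as their constant terms do.
  product-const : ∀ {n} (g : Vector Carrier n) →
    Polynomials.product (λ i → g i ∷ []) ≋ (Coefficients.product g ∷ [])
  product-const {zero}  g k = ≈-refl
  product-const {suc n} g k = begin
    coeff ((g₀ ∷ []) ⊛ Polynomials.product (λ i → g′ i ∷ [])) k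
      ≈⟨ const-⊛ g₀ (Polynomials.product (λ i → g′ i ∷ [])) k ⟩
    g₀ * coeff (Polynomials.product (λ i → g′ i ∷ [])) k
      ≈⟨ *-congˡ (product-const g′ k) ⟩
    g₀ * coeff (Coefficients.product g′ ∷ []) k
      ≈⟨ coeff-map g₀ (Coefficients.product g′ ∷ []) k ⟨
    coeff (g₀ * Coefficients.product g′ ∷ []) k ∎
    where
    g₀ = g zero
    g′ : Vector Carrier n
    g′ i = g (suc i)

  X : List Carrier
  X = 0# ∷ 1# ∷ []

  X-⊛ : ∀ f → (X ⊛ f) ≋ (0# ∷ f)
  X-⊛ f k = ≈-trans (shift-⊛ 1ᴾ f k) (∷-cong (1ᴾ ⊛ f) f ≈-refl (⊛-identityˡ f) k)

  linear≋ : ∀ c → ((c ∷ []) ⊕ X) ≋ (c ∷ 1# ∷ [])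
  linear≋ c = ∷-cong 1ᴾ 1ᴾ (+-identityʳ c) (λ _ → ≈-refl)

  linear-⊛-const : ∀ u h →
    ((u ∷ 1# ∷ []) ⊛ (h ∷ [])) ≋ (u * h ∷ h ∷ [])
  linear-⊛-const u h zero          = +-identityʳ _
  linear-⊛-const u h (suc zero)    = ≈-trans (+-identityʳ _) (*-identityˡ h)
  linear-⊛-const u h (suc (suc k)) = ≈-refl

  linear-⊛-linear : ∀ u h i →
    ((u ∷ 1# ∷ []) ⊛ (h ∷ i ∷ [])) ≋ (u * h ∷ u * i + h ∷ i ∷ [])
  linear-⊛-linear u h i zero                = +-identityʳ _
  linear-⊛-linear u h i (suc zero)          = +-congˡ (≈-trans (+-identityʳ _) (*-identityˡ h))
  linear-⊛-linear u h i (suc (suc zero))    = *-identityˡ i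
  linear-⊛-linear u h i (suc (suc (suc k))) = ≈-refl

  -- With X as x₁ and y as x₂, this adjoins the factor 1 + x₁ + x₂ to a product free of x₁.
  factor-⊛ : ∀ y h f → f ≋ (h ∷ []) →
    ((1ᴾ ⊕ X ⊕ (y ∷ [])) ⊛ f) ≋ ((1# + y) * h ∷ h ∷ [])
  factor-⊛ y h f eq k = ≈-trans
    (⊛-cong (1ᴾ ⊕ X ⊕ (y ∷ [])) (1# + y ∷ 1# ∷ []) f (h ∷ [])
      (∷-cong 1ᴾ 1ᴾ (+-congʳ (+-identityʳ 1#)) (λ _ → ≈-refl)) eq k)
    (linear-⊛-const (1# + y) h k)

  -- The middle coefficient c h + (1 + y) h is again a linear factor in y times h, with c raised by
  -- one. The bracketing `(1# + c) + y` is the form in which `ι-suc` applies.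
  linear-⊛ : ∀ c y h f → f ≋ ((1# + y) * h ∷ h ∷ []) →
    (((c ∷ []) ⊕ X) ⊛ f) ≋ (c * ((1# + y) * h) ∷ ((1# + c) + y) * h ∷ h ∷ [])
  linear-⊛ c y h f eq k = begin
    coeff (((c ∷ []) ⊕ X) ⊛ f) k
      ≈⟨ ⊛-cong ((c ∷ []) ⊕ X) (c ∷ 1# ∷ []) f (v ∷ h ∷ []) (linear≋ c) eq k ⟩
    coeff ((c ∷ 1# ∷ []) ⊛ (v ∷ h ∷ [])) k
      ≈⟨ linear-⊛-linear c v h k ⟩
    coeff (c * v ∷ c * h + v ∷ h ∷ []) k
      ≈⟨ ∷-cong (c * h + v ∷ h ∷ []) (((1# + c) + y) * h ∷ h ∷ []) ≈-refl
           (∷-cong (h ∷ []) (h ∷ []) middle (λ _ → ≈-refl)) k ⟩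
    coeff (c * v ∷ ((1# + c) + y) * h ∷ h ∷ []) k ∎
    where
    v : Carrier
    v = (1# + y) * h
    middle : c * h + v ≈ ((1# + c) + y) * h
    middle = begin
      c * h + (1# + y) * h  ≈⟨ distribʳ h c (1# + y) ⟨
      (c + (1# + y)) * h    ≈⟨ *-congʳ (+-assoc c 1# y) ⟨
      (c + 1# + y) * h      ≈⟨ *-congʳ (+-congʳ (+-comm c 1#)) ⟩
      ((1# + c) + y) * h    ∎

  X-linear-⊛ : ∀ c f → c ≈ 0# → (((c ∷ []) ⊕ X) ⊛ f) ≋ (0# ∷ f)
  X-linear-⊛ c f c≈0 k = ≈-trans
    (⊛-cong ((c ∷ []) ⊕ X) X f f
      (λ j → ≈-trans (linear≋ c j) (∷-cong 1ᴾ 1ᴾ c≈0 (λ _ → ≈-refl) j)) (λ _ → ≈-refl) k)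
    (X-⊛ f k)

  linear-⊛-1 : ∀ c → (((c ∷ []) ⊕ X) ⊛ 1ᴾ) ≋ (c ∷ 1# ∷ [])
  linear-⊛-1 c k = ≈-trans (⊛-identityʳ ((c ∷ []) ⊕ X) k) (linear≋ c k)

-- Arithmetic in 𝔽_p.

module _ (p : ℕ) .{{_ : NonZero p}} where

  private module 𝔽ₚ = RawSemiring (𝔽 p)

  toℕ-mod : ∀ m → toℕ (m mod p) ≡ m % p
  toℕ-mod m = Fin.toℕ-fromℕ< _

  mod-cong : ∀ m n → m % p ≡ n % p → m mod p ≡ n mod p
  mod-cong m n eq = Fin.toℕ-injective (trans (toℕ-mod m) (trans eq (sym (toℕ-mod n))))

  mod-toℕ : ∀ (a : Fin p) → toℕ a mod p ≡ a
  mod-toℕ a = Fin.toℕ-injective (trans (toℕ-mod (toℕ a)) (m<n⇒m%n≡m (Fin.toℕ<n a)))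

  module ModHomomorphism (_∙_ : ℕ → ℕ → ℕ)
    (%-distrib : ∀ m n → (m ∙ n) % p ≡ ((m % p) ∙ (n % p)) % p) where

    mod-∙ : ∀ m n → (toℕ (m mod p) ∙ toℕ (n mod p)) mod p ≡ (m ∙ n) mod p
    mod-∙ m n = mod-cong _ (m ∙ n)
      (trans (cong₂ (λ a b → (a ∙ b) % p) (toℕ-mod m) (toℕ-mod n)) (sym (%-distrib m n)))

    mod-∙ˡ : ∀ m (b : Fin p) → (toℕ (m mod p) ∙ toℕ b) mod p ≡ (m ∙ toℕ b) mod p
    mod-∙ˡ m b = trans
      (cong (λ c → (toℕ (m mod p) ∙ toℕ c) mod p) (sym (mod-toℕ b))) (mod-∙ m (toℕ b))

    mod-∙ʳ : ∀ (a : Fin p) n → (toℕ a ∙ toℕ (n mod p)) mod p ≡ (toℕ a ∙ n) mod p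
    mod-∙ʳ a n = trans
      (cong (λ c → (toℕ c ∙ toℕ (n mod p)) mod p) (sym (mod-toℕ a))) (mod-∙ (toℕ a) n)

  open ModHomomorphism ℕ._+_ (λ m n → %-distribˡ-+ m n p) public
    renaming (mod-∙ to mod-+; mod-∙ˡ to mod-+ˡ; mod-∙ʳ to mod-+ʳ)
  open ModHomomorphism ℕ._*_ (λ m n → %-distribˡ-* m n p) public
    using () renaming (mod-∙ˡ to mod-*ˡ; mod-∙ʳ to mod-*ʳ)

  -- Once inner reductions are removed, each law is the image under `_mod p` of the corresponding
  -- law in ℕ.
  𝔽-laws : SemiringLaws (𝔽 p)
  𝔽-laws = IsCommutativeSemiring.isSemiring (isCommutativeSemiringˡ record
    { +-isCommutativeMonoid = isCommutativeMonoidˡ record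
      { isSemigroup = record
        { isMagma = record { isEquivalence = isEquivalence ; ∙-cong = cong₂ 𝔽ₚ._+_ }
        ; assoc   = λ a b c → trans (mod-+ˡ _ c)
            (trans (cong (_mod p) (ℕ.+-assoc (toℕ a) (toℕ b) (toℕ c))) (sym (mod-+ʳ a _)))
        }
      ; identityˡ = λ a → trans (mod-+ˡ 0 a) (mod-toℕ a)
      ; comm      = λ a b → cong (_mod p) (ℕ.+-comm (toℕ a) (toℕ b))
      }
    ; *-isCommutativeMonoid = isCommutativeMonoidˡ record
      { isSemigroup = record
        { isMagma = record { isEquivalence = isEquivalence ; ∙-cong = cong₂ 𝔽ₚ._*_ }
        ; assoc   = λ a b c → trans (mod-*ˡ _ c)
            (trans (cong (_mod p) (ℕ.*-assoc (toℕ a) (toℕ b) (toℕ c))) (sym (mod-*ʳ a _)))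
        }
      ; identityˡ = λ a → trans (mod-*ˡ 1 a)
          (trans (cong (_mod p) (ℕ.*-identityˡ (toℕ a))) (mod-toℕ a))
      ; comm      = λ a b → cong (_mod p) (ℕ.*-comm (toℕ a) (toℕ b))
      }
    ; distribʳ = λ c a b → trans (mod-*ˡ _ c)
        (trans (cong (_mod p) (ℕ.*-distribʳ-+ (toℕ c) (toℕ a) (toℕ b))) (sym (mod-+ _ _)))
    ; zeroˡ    = λ a → mod-*ˡ 0 a
    })
    where open Algebra.Structures.Biased {A = Fin p} _≡_

  mod≡0⇒∣ : ∀ m → m mod p ≡ 0 mod p → p ∣ m
  mod≡0⇒∣ m eq = m%n≡0⇒n∣m m p (begin
    m % p          ≡⟨ toℕ-mod m ⟨
    toℕ (m mod p)  ≡⟨ cong toℕ eq ⟩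
    toℕ (0 mod p)  ≡⟨ toℕ-mod 0 ⟩
    0 % p          ≡⟨ m<n⇒m%n≡m (ℕ.>-nonZero⁻¹ p) ⟩
    0              ∎)
    where open ≡-Reasoning

  ∣⇒mod≡0 : ∀ m → p ∣ m → m mod p ≡ 0 mod p
  ∣⇒mod≡0 m p∣m = mod-cong m 0
    (trans (n∣m⇒m%n≡0 m p p∣m) (sym (m<n⇒m%n≡m (ℕ.>-nonZero⁻¹ p))))

  -- Vanishing modulo p is divisibility by p, so Euclid's lemma applies.
  𝔽-integral : Prime p → ∀ a b → a 𝔽ₚ.* b ≡ 𝔽ₚ.0# → a ≡ 𝔽ₚ.0# ⊎ b ≡ 𝔽ₚ.0#
  𝔽-integral p-prime a b ab≡0 = Sum.map (zero-if a) (zero-if b)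
    (euclidsLemma (toℕ a) (toℕ b) p-prime (mod≡0⇒∣ _ ab≡0))
    where
    zero-if : ∀ c → p ∣ toℕ c → c ≡ 𝔽ₚ.0#
    zero-if c p∣c = trans (sym (mod-toℕ c)) (∣⇒mod≡0 (toℕ c) p∣c)

  -- Iterated polynomial rings over 𝔽_p and their constants.

  laws : ∀ m → SemiringLaws (𝔽 p [X₁⋯X m ])
  laws zero    = 𝔽-laws
  laws (suc m) = Polynomial.polynomialLaws (𝔽 p [X₁⋯X m ]) (laws m)

  module Ring (m : ℕ) where
    open RawSemiring (𝔽 p [X₁⋯X m ]) public using (Carrier; _≈_; _+_; _*_; 0#; 1#)
    open IsSemiring (laws m) public hiding (refl; sym; trans; zero)
    open IsSemiring (laws m) public using () renaming (refl to ≈-refl; sym to ≈-sym; trans to ≈-trans)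
    open Polynomial (𝔽 p [X₁⋯X m ]) (laws m) public
    open Univariate (𝔽 p [X₁⋯X m ]) public

  -- Constants are indexed by ℕ rather than by residues, so that c can climb by successors from 1 to
  -- p, where the image is zero.
  ι : ∀ m → ℕ → Ring.Carrier m
  ι zero    c = c mod p
  ι (suc m) c = ι m c ∷ []

  ι-1 : ∀ m → ι m 1 ≡ Ring.1# m
  ι-1 zero    = refl
  ι-1 (suc m) = cong (_∷ []) (ι-1 m)

  ι-suc : ∀ m c → Ring._+_ m (Ring.1# m) (ι m c) ≡ ι m (suc c)
  ι-suc zero    c = mod-+ 1 c
  ι-suc (suc m) c = cong (_∷ []) (ι-suc m c)

  -- Only `_≈_` is claimed: for positive m, `ι m p` is a nest of singletons around a zero, while
  -- `0#` is the empty list.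
  ι-p : ∀ m → Ring._≈_ m (ι m p) (Ring.0# m)
  ι-p zero          = mod-cong p 0 (trans (n%n≡0 p) (sym (m<n⇒m%n≡m (ℕ.>-nonZero⁻¹ p))))
  ι-p (suc m) zero    = ι-p m
  ι-p (suc m) (suc k) = Ring.≈-refl m

  mod≢0 : ∀ c .{{_ : NonZero c}} → c < p → c mod p ≢ 𝔽ₚ.0#
  mod≢0 c c<p eq = ℕ.≢-nonZero⁻¹ c (begin
    c              ≡⟨ m<n⇒m%n≡m c<p ⟨
    c % p          ≡⟨ n∣m⇒m%n≡0 c p (mod≡0⇒∣ c eq) ⟩
    0              ∎)
    where open ≡-Reasoning

  -- Invariance of the number of nonzero coefficients.

  N-zero : ∀ m f → Ring._≈_ m f (Ring.0# m) → N p m f ≡ 0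
  N-zero zero a eq with a Fin.≟ 𝔽ₚ.0#
  ... | yes _  = refl
  ... | no a≢0 = contradiction eq a≢0
  N-zero (suc m) []      eq = refl
  N-zero (suc m) (a ∷ f) eq =
    cong₂ ℕ._+_ (N-zero m a (eq 0)) (N-zero (suc m) f (eq ∘ suc))

  N-nonzero : ∀ a → a ≢ 𝔽ₚ.0# → N p 0 a ≡ 1
  N-nonzero a a≢0 with a Fin.≟ 𝔽ₚ.0#
  ... | yes a≡0 = contradiction a≡0 a≢0
  ... | no _    = refl

  -- `N` is defined on representations, which may differ by padding; by `N-zero` a surplus tail
  -- contributes nothing.
  N-cong : ∀ m f g → Ring._≈_ m f g → N p m f ≡ N p m g
  N-cong zero    a       .a      refl = refl
  N-cong (suc m) []      g       eq   = sym (N-zero (suc m) g (Ring.≈-sym m ∘ eq))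
  N-cong (suc m) (a ∷ f) []      eq   = N-zero (suc m) (a ∷ f) eq
  N-cong (suc m) (a ∷ f) (b ∷ g) eq   =
    cong₂ ℕ._+_ (N-cong m a b (eq 0)) (N-cong (suc m) f g (eq ∘ suc))

  -- A nonzero constant of 𝔽_p is not a zero divisor, so scaling neither creates nor destroys a zero
  -- coefficient.
  N-scale : Prime p → ∀ m c f → c mod p ≢ 𝔽ₚ.0# → N p m (Ring._*_ m (ι m c) f) ≡ N p m f
  N-scale p-prime zero c a c≢0 with a Fin.≟ 𝔽ₚ.0#
  ... | yes refl = N-zero zero _ (Ring.zeroʳ zero (c mod p))
  ... | no a≢0   = N-nonzero _ ([ c≢0 , a≢0 ]′ ∘ 𝔽-integral p-prime (c mod p) a)
  N-scale p-prime (suc m) c f c≢0 = trans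
    (N-cong (suc m) ((ι m c ∷ []) ⊛ f) (map (ι m c *_) f) const-⊛-map) (scale-each f)
    where
    open Ring m
    const-⊛-map : ∀ k → coeff ((ι m c ∷ []) ⊛ f) k ≈ coeff (map (ι m c *_) f) k
    const-⊛-map k = ≈-trans (const-⊛ (ι m c) f k) (≈-sym (coeff-map (ι m c) f k))

    scale-each : ∀ f → N p (suc m) (map (ι m c *_) f) ≡ N p (suc m) f
    scale-each []      = refl
    scale-each (a ∷ f) = cong₂ ℕ._+_ (N-scale p-prime m c a c≢0) (scale-each f)

  -- Recurrences for the coefficient counts.

  Hₚ : ∀ n → Ring.Carrier (suc n)
  Hₚ = H (𝔽 p)

  x₁ : ∀ n → Ring.Carrier (suc n)
  x₁ n = x (𝔽 p) {suc n} zero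

  -- The factors after the first involve only x₂, x₃, ..., and each unfolds to a singleton list
  -- holding a factor of `Hₚ n` in shifted variables.
  H-suc : ∀ n → let open Ring (suc n) in
    Ring._≈_ (2 ℕ.+ n) (Hₚ (suc n)) ((1# + x₁ n) * Hₚ n ∷ Hₚ n ∷ [])
  H-suc n = factor-⊛ (x₁ n) (Hₚ n) (Polynomials.product (λ i → g i ∷ [])) (product-const g)
    where
    open Ring (suc n)
    g : Fin n → Carrier
    g i = 1# + x (𝔽 p) (inject₁ i) + x (𝔽 p) (suc i)

  linear·H : ∀ n → Ring.Carrier (suc n) → Ring.Carrier (suc n)
  linear·H n c = (c + x₁ n) * Hₚ n
    where open Ring (suc n)

  countH : ℕ → ℕ
  countH n = N p (suc n) (Hₚ n)

  countLinear : ℕ → ℕ → ℕ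
  countLinear c n = N p (suc n) (linear·H n (ι (suc n) c))

  countLinear-1 : ∀ n → N p (suc n) (linear·H n (Ring.1# (suc n))) ≡ countLinear 1 n
  countLinear-1 n = cong (λ c → N p (suc n) (linear·H n c)) (sym (ι-1 (suc n)))

  countH-suc : ∀ n → countH (suc n) ≡ countLinear 1 n ℕ.+ countH n
  countH-suc n = begin
    N p (2 ℕ.+ n) (Hₚ (suc n))
      ≡⟨ N-cong (2 ℕ.+ n) (Hₚ (suc n)) (linear·H n 1# ∷ Hₚ n ∷ []) (H-suc n) ⟩
    N p (suc n) (linear·H n 1#) ℕ.+ (countH n ℕ.+ 0)
      ≡⟨ cong₂ ℕ._+_ (countLinear-1 n) (ℕ.+-identityʳ (countH n)) ⟩
    countLinear 1 n ℕ.+ countH n ∎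
    where
    open Ring (suc n)
    open ≡-Reasoning

  -- The constant p vanishes, and multiplication by x₁ merely prepends a zero coefficient, which is
  -- not counted.
  countLinear-p : ∀ n → countLinear p n ≡ countH n
  countLinear-p n = trans
    (N-cong (suc n) (linear·H n (ι (suc n) p)) (0# ∷ Hₚ n) (X-linear-⊛ (ι n p) (Hₚ n) (ι-p n)))
    (cong (ℕ._+ countH n) (N-zero n 0# ≈-refl))
    where open Ring n

  countLinear-suc : Prime p → ∀ c .{{_ : NonZero c}} → c < p → ∀ n →
    countLinear c (suc n) ≡ countH (suc n) ℕ.+ countLinear (suc c) n
  countLinear-suc p-prime c c<p n = begin
    N p (2 ℕ.+ n) (linear·H (suc n) (ι (2 ℕ.+ n) c))
      ≡⟨ N-cong (2 ℕ.+ n) (linear·H (suc n) (ι (2 ℕ.+ n) c))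
           (cₙ * linear·H n 1# ∷ linear·H n (1# + cₙ) ∷ Hₚ n ∷ [])
           (linear-⊛ cₙ (x₁ n) (Hₚ n) (Hₚ (suc n)) (H-suc n)) ⟩
    N p (suc n) (cₙ * linear·H n 1#) ℕ.+ (N p (suc n) (linear·H n (1# + cₙ)) ℕ.+ (countH n ℕ.+ 0))
      ≡⟨ cong₂ ℕ._+_
           (trans (N-scale p-prime (suc n) c (linear·H n 1#) (mod≢0 c c<p)) (countLinear-1 n))
           (cong₂ ℕ._+_
             (cong (λ d → N p (suc n) (linear·H n d)) (ι-suc (suc n) c)) (ℕ.+-identityʳ (countH n))) ⟩
    countLinear 1 n ℕ.+ (countLinear (suc c) n ℕ.+ countH n)
      ≡⟨ cong (countLinear 1 n ℕ.+_) (ℕ.+-comm (countLinear (suc c) n) (countH n)) ⟩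
    countLinear 1 n ℕ.+ (countH n ℕ.+ countLinear (suc c) n)
      ≡⟨ ℕ.+-assoc (countLinear 1 n) (countH n) (countLinear (suc c) n) ⟨
    countLinear 1 n ℕ.+ countH n ℕ.+ countLinear (suc c) n
      ≡⟨ cong (ℕ._+ countLinear (suc c) n) (countH-suc n) ⟨
    countH (suc n) ℕ.+ countLinear (suc c) n ∎
    where
    open Ring (suc n)
    open ≡-Reasoning
    cₙ : Carrier
    cₙ = ι (suc n) c

  N-1 : 1 < p → N p 0 𝔽ₚ.1# ≡ 1
  N-1 1<p = N-nonzero 𝔽ₚ.1# (mod≢0 1 1<p)

  countH-0 : 1 < p → countH 0 ≡ 1
  countH-0 1<p = trans (ℕ.+-identityʳ _) (N-1 1<p)

  -- As H₀ = 1, what is counted is c + x₁ itself, and both of its coefficients are nonzero.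
  countLinear-0 : 1 < p → ∀ c .{{_ : NonZero c}} → c < p → countLinear c 0 ≡ 2
  countLinear-0 1<p c c<p = begin
    N p 1 (linear·H 0 (ι 1 c))
      ≡⟨ N-cong 1 (linear·H 0 (ι 1 c)) (c mod p ∷ 𝔽ₚ.1# ∷ []) (Ring.linear-⊛-1 0 (c mod p)) ⟩
    N p 0 (c mod p) ℕ.+ (N p 0 𝔽ₚ.1# ℕ.+ 0)
      ≡⟨ cong₂ (λ s t → s ℕ.+ (t ℕ.+ 0)) (N-nonzero (c mod p) (mod≢0 c c<p)) (N-1 1<p) ⟩
    2 ∎
    where open ≡-Reasoning

-- The commutative ring of formal power series.

open PowerSeries

infixr 8 _·_
-- Scalar multiples arise because the tail of `f * g` unfolds to `f 0 · g ∘ suc + f ∘ suc * g`.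
_·_ : ℤ → Carrier → Carrier
(a · f) n = a ℤ.* f n

*-cong : ∀ {f f′ g g′} → f ≈ f′ → g ≈ g′ → f * g ≈ f′ * g′
*-cong p q zero    = cong (ℤ._+ 0ℤ) (cong₂ ℤ._*_ (p 0) (q 0))
*-cong p q (suc n) =
  cong₂ ℤ._+_ (cong₂ ℤ._*_ (p 0) (q (suc n))) (*-cong (p ∘ suc) q n)

*-distribʳ : ∀ h f g → (f + g) * h ≈ f * h + g * h
*-distribʳ h f g zero    = lemma (f 0) (g 0) (h 0)
  where
  lemma : ∀ a b c → (a ℤ.+ b) ℤ.* c ℤ.+ 0ℤ ≡ (a ℤ.* c ℤ.+ 0ℤ) ℤ.+ (b ℤ.* c ℤ.+ 0ℤ)
  lemma = solve-∀
*-distribʳ h f g (suc n) = begin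
  (f 0 ℤ.+ g 0) ℤ.* h (suc n) ℤ.+ ((f ∘ suc + g ∘ suc) * h) n
    ≡⟨ cong (λ s → (f 0 ℤ.+ g 0) ℤ.* h (suc n) ℤ.+ s) (*-distribʳ h (f ∘ suc) (g ∘ suc) n) ⟩
  (f 0 ℤ.+ g 0) ℤ.* h (suc n) ℤ.+ ((f ∘ suc * h) n ℤ.+ (g ∘ suc * h) n)
    ≡⟨ lemma (f 0) (g 0) (h (suc n)) ((f ∘ suc * h) n) ((g ∘ suc * h) n) ⟩
  (f * h + g * h) (suc n) ∎
  where
  open ≡-Reasoning
  lemma : ∀ a b c s t →
    (a ℤ.+ b) ℤ.* c ℤ.+ (s ℤ.+ t) ≡ (a ℤ.* c ℤ.+ s) ℤ.+ (b ℤ.* c ℤ.+ t)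
  lemma = solve-∀

·-* : ∀ a f g → (a · f) * g ≈ a · (f * g)
·-* a f g zero    = lemma a (f 0) (g 0)
  where
  lemma : ∀ a b c → a ℤ.* b ℤ.* c ℤ.+ 0ℤ ≡ a ℤ.* (b ℤ.* c ℤ.+ 0ℤ)
  lemma = solve-∀
·-* a f g (suc n) = begin
  a ℤ.* f 0 ℤ.* g (suc n) ℤ.+ ((a · f ∘ suc) * g) n
    ≡⟨ cong (λ s → a ℤ.* f 0 ℤ.* g (suc n) ℤ.+ s) (·-* a (f ∘ suc) g n) ⟩
  a ℤ.* f 0 ℤ.* g (suc n) ℤ.+ a ℤ.* (f ∘ suc * g) n
    ≡⟨ lemma a (f 0) (g (suc n)) ((f ∘ suc * g) n) ⟩
  a ℤ.* (f * g) (suc n) ∎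
  where
  open ≡-Reasoning
  lemma : ∀ a b c s → a ℤ.* b ℤ.* c ℤ.+ a ℤ.* s ≡ a ℤ.* (b ℤ.* c ℤ.+ s)
  lemma = solve-∀

*-assoc : ∀ f g h → (f * g) * h ≈ f * (g * h)
*-assoc f g h zero    = lemma (f 0) (g 0) (h 0)
  where
  lemma : ∀ a b c → (a ℤ.* b ℤ.+ 0ℤ) ℤ.* c ℤ.+ 0ℤ ≡ a ℤ.* (b ℤ.* c ℤ.+ 0ℤ) ℤ.+ 0ℤ
  lemma = solve-∀
*-assoc f g h (suc n) = begin
  (f * g) 0 ℤ.* h (suc n) ℤ.+ ((f 0 · g ∘ suc + f ∘ suc * g) * h) n
    ≡⟨ cong (λ s → (f * g) 0 ℤ.* h (suc n) ℤ.+ s) (begin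
       ((f 0 · g ∘ suc + f ∘ suc * g) * h) n
         ≡⟨ *-distribʳ h (f 0 · g ∘ suc) (f ∘ suc * g) n ⟩
       ((f 0 · g ∘ suc) * h) n ℤ.+ ((f ∘ suc * g) * h) n
         ≡⟨ cong₂ ℤ._+_ (·-* (f 0) (g ∘ suc) h n) (*-assoc (f ∘ suc) g h n) ⟩
       f 0 ℤ.* (g ∘ suc * h) n ℤ.+ (f ∘ suc * (g * h)) n ∎) ⟩
  (f 0 ℤ.* g 0 ℤ.+ 0ℤ) ℤ.* h (suc n) ℤ.+ (f 0 ℤ.* (g ∘ suc * h) n ℤ.+ (f ∘ suc * (g * h)) n)
    ≡⟨ lemma (f 0) (g 0) (h (suc n)) ((g ∘ suc * h) n) ((f ∘ suc * (g * h)) n) ⟩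
  (f * (g * h)) (suc n) ∎
  where
  open ≡-Reasoning
  lemma : ∀ a b c s t →
    (a ℤ.* b ℤ.+ 0ℤ) ℤ.* c ℤ.+ (a ℤ.* s ℤ.+ t) ≡ a ℤ.* (b ℤ.* c ℤ.+ s) ℤ.+ t
  lemma = solve-∀

-- The convolution unfolds only in its left factor. Unfolding once in each order leaves the product
-- of both tails two coefficients lower, hence the step of two and the base cases 0 and 1.
*-comm : ∀ f g → f * g ≈ g * f
*-comm f g zero          = cong (ℤ._+ 0ℤ) (ℤ.*-comm (f 0) (g 0))
*-comm f g (suc zero)    = lemma (f 0) (f 1) (g 0) (g 1)
  where
  lemma : ∀ a a′ b b′ →
    a ℤ.* b′ ℤ.+ (a′ ℤ.* b ℤ.+ 0ℤ) ≡ b ℤ.* a′ ℤ.+ (b′ ℤ.* a ℤ.+ 0ℤ)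
  lemma = solve-∀
*-comm f g (suc (suc n)) = begin
  f 0 ℤ.* g (2 ℕ.+ n) ℤ.+ (f ∘ suc * g) (suc n)
    ≡⟨ cong (λ s → f 0 ℤ.* g (2 ℕ.+ n) ℤ.+ s) (*-comm (f ∘ suc) g (suc n)) ⟩
  f 0 ℤ.* g (2 ℕ.+ n) ℤ.+ (g 0 ℤ.* f (2 ℕ.+ n) ℤ.+ (g ∘ suc * f ∘ suc) n)
    ≡⟨ cong (λ s → f 0 ℤ.* g (2 ℕ.+ n) ℤ.+ (g 0 ℤ.* f (2 ℕ.+ n) ℤ.+ s)) (*-comm (g ∘ suc) (f ∘ suc) n) ⟩
  f 0 ℤ.* g (2 ℕ.+ n) ℤ.+ (g 0 ℤ.* f (2 ℕ.+ n) ℤ.+ (f ∘ suc * g ∘ suc) n)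
    ≡⟨ lemma (f 0 ℤ.* g (2 ℕ.+ n)) (g 0 ℤ.* f (2 ℕ.+ n)) ((f ∘ suc * g ∘ suc) n) ⟩
  g 0 ℤ.* f (2 ℕ.+ n) ℤ.+ (f * g ∘ suc) (suc n)
    ≡⟨ cong (λ s → g 0 ℤ.* f (2 ℕ.+ n) ℤ.+ s) (*-comm f (g ∘ suc) (suc n)) ⟩
  (g * f) (suc (suc n)) ∎
  where
  open ≡-Reasoning
  lemma : ∀ a b s → a ℤ.+ (b ℤ.+ s) ≡ b ℤ.+ (a ℤ.+ s)
  lemma = solve-∀

*-zeroˡ : ∀ f → 0# * f ≈ 0#
*-zeroˡ f zero    = refl
*-zeroˡ f (suc n) = trans (ℤ.+-identityˡ _) (*-zeroˡ f n)

*-identityˡ : ∀ f → 1# * f ≈ f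
*-identityˡ f zero    = trans (ℤ.+-identityʳ _) (ℤ.*-identityˡ (f 0))
*-identityˡ f (suc n) = begin
  1ℤ ℤ.* f (suc n) ℤ.+ (0# * f) n ≡⟨ cong₂ ℤ._+_ (ℤ.*-identityˡ (f (suc n))) (*-zeroˡ f n) ⟩
  f (suc n) ℤ.+ 0ℤ                ≡⟨ ℤ.+-identityʳ _ ⟩
  f (suc n)                       ∎
  where open ≡-Reasoning

z-* : ∀ f n → (z * f) (suc n) ≡ f n
z-* f n = trans (ℤ.+-identityˡ _)
  (trans (*-cong {z ∘ suc} {1#} {f} tail (λ _ → refl) n) (*-identityˡ f n))
  where
  tail : z ∘ suc ≈ 1#
  tail zero    = refl
  tail (suc n) = refl

≈-trans : ∀ {f g h} → f ≈ g → g ≈ h → f ≈ h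
≈-trans p q n = trans (p n) (q n)

powerSeriesRing : CommutativeRing 0ℓ 0ℓ
powerSeriesRing = record
  { Carrier = Carrier
  ; _≈_ = _≈_
  ; _+_ = _+_
  ; _*_ = _*_
  ; -_  = -_
  ; 0#  = 0#
  ; 1#  = 1#
  ; isCommutativeRing = record
    { isRing = record
      { +-isAbelianGroup = record
        { isGroup = record
          { isMonoid = record
            { isSemigroup = record
              { isMagma = record
                { isEquivalence = record
                  { refl  = λ _ → refl
                  ; sym   = λ p n → sym (p n)
                  ; trans = λ p q n → trans (p n) (q n)
                  }
                ; ∙-cong = λ p q n → cong₂ ℤ._+_ (p n) (q n)
                }
              ; assoc = λ f g h n → ℤ.+-assoc (f n) (g n) (h n)
              }
            ; identity = (λ f n → ℤ.+-identityˡ (f n)) , (λ f n → ℤ.+-identityʳ (f n))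
            }
          ; inverse = (λ f n → ℤ.+-inverseˡ (f n)) , (λ f n → ℤ.+-inverseʳ (f n))
          ; ⁻¹-cong = λ p n → cong ℤ.-_ (p n)
          }
        ; comm = λ f g n → ℤ.+-comm (f n) (g n)
        }
      ; *-cong = λ {f} {f′} {g} {g′} → *-cong {f} {f′} {g} {g′}
      ; *-assoc = *-assoc
      ; *-identity = *-identityˡ , λ f → ≈-trans (*-comm f 1#) (*-identityˡ f)
      ; distrib = (λ f g h → ≈-trans (*-comm f (g + h)) (≈-trans (*-distribʳ f g h)
                     (λ n → cong₂ ℤ._+_ (*-comm g f n) (*-comm h f n))))
                , *-distribʳ
      }
    ; *-comm = *-comm
    }
  }

-- Constant series, the ring solver and quotients of series.

const : ℤ → Carrier
const a zero    = a
const a (suc _) = 0ℤ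

constHomomorphism :
  CommutativeRing.rawRing ℤ.+-*-commutativeRing -Raw-AlmostCommutative⟶
  fromCommutativeRing powerSeriesRing
constHomomorphism = record
  { ⟦_⟧    = const
  ; +-homo = λ { a b zero → refl ; a b (suc n) → refl }
  ; *-homo = λ { a b zero → sym (ℤ.+-identityʳ _)
               ; a b (suc n) → sym (cong₂ ℤ._+_ (ℤ.*-zeroʳ a) (*-zeroˡ (const b) n)) }
  ; -‿homo = λ { a zero → refl ; a (suc n) → refl }
  ; 0-homo = λ { zero → refl ; (suc n) → refl }
  ; 1-homo = λ { zero → refl ; (suc n) → refl }
  }

const-≟ : ∀ a b → Maybe (const a ≈ const b)
const-≟ a b = Maybe.map (λ { refl _ → refl }) (dec⇒maybe (a ℤ.≟ b))

module Solver = Algebra.Solver.Ring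
  (CommutativeRing.rawRing ℤ.+-*-commutativeRing)
  (fromCommutativeRing powerSeriesRing)
  constHomomorphism
  const-≟

-- Long division, meaningful only when the divisor has constant coefficient 1.
infixl 7 _÷_
_÷_ : Carrier → Carrier → Carrier
(r ÷ f) zero    = r 0
(r ÷ f) (suc n) = ((r ∘ suc - (r 0 · f ∘ suc)) ÷ f) n

-- Since `f 0` is 1, the quotient's coefficient `r 0` cancels the leading term; the tail of
-- `r - (r 0 · f)` remains to be divided.
÷-* : ∀ r f → f 0 ≡ 1ℤ → (r ÷ f) * f ≈ r
÷-* r f f₀ zero    =
  trans (ℤ.+-identityʳ _) (trans (cong (r 0 ℤ.*_) f₀) (ℤ.*-identityʳ (r 0)))
÷-* r f f₀ (suc n) = begin
  r 0 ℤ.* f (suc n) ℤ.+ ((r ∘ suc - (r 0 · f ∘ suc)) ÷ f * f) n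
    ≡⟨ cong (λ s → r 0 ℤ.* f (suc n) ℤ.+ s) (÷-* (r ∘ suc - (r 0 · f ∘ suc)) f f₀ n) ⟩
  r 0 ℤ.* f (suc n) ℤ.+ (r (suc n) ℤ.- r 0 ℤ.* f (suc n))
    ≡⟨ lemma (r 0 ℤ.* f (suc n)) (r (suc n)) ⟩
  r (suc n) ∎
  where
  open ≡-Reasoning
  lemma : ∀ a b → a ℤ.+ (b ℤ.- a) ≡ b
  lemma = solve-∀

-- Constant coefficient 1 makes h a unit with inverse `1# ÷ h`, by which `f * h ≈ g` is multiplied.
≈-/ : ∀ f g h → h 0 ≡ 1ℤ → f * h ≈ g → f ≈ g / h
≈-/ f g h h₀ fh≈g = (1# ÷ h , left , right) , quotient
  where
  left : (1# ÷ h) * h ≈ 1#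
  left = ÷-* 1# h h₀
  right : h * (1# ÷ h) ≈ 1#
  right = ≈-trans (*-comm h (1# ÷ h)) left
  open Relation.Binary.Reasoning.Setoid (CommutativeRing.setoid powerSeriesRing)
  quotient : f ≈ g * (1# ÷ h)
  quotient = begin
    f                  ≈⟨ CommutativeRing.*-identityʳ powerSeriesRing f ⟨
    f * 1#             ≈⟨ *-cong {f} {f} {h * (1# ÷ h)} {1#} (λ _ → refl) right ⟨
    f * (h * (1# ÷ h)) ≈⟨ *-assoc f h (1# ÷ h) ⟨
    f * h * (1# ÷ h)   ≈⟨ *-cong {f * h} {g} {1# ÷ h} {1# ÷ h} fh≈g (λ _ → refl) ⟩
    g * (1# ÷ h)       ∎

-- Elimination of the auxiliary series from the linear system.

module Elimination (p : ℕ) (A : Carrier) (B : ℕ → Carrier)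
  (A-eq   : A ≈ 1# + z * (A + B 1))
  (B-eq   : ∀ c .{{_ : NonZero c}} → c < p → B c ≈ 1# + A + z * B (suc c))
  (B-last : B p ≈ A) where

  open CommutativeRing powerSeriesRing using (+-congˡ; +-congʳ; *-congˡ; setoid)
  open Relation.Binary.Reasoning.Setoid setoid
  open Solver using (Polynomial; solve; _:+_; _:*_; _:-_; _:^_; _:=_)

  -- The solver's constants denote const k, which is not definitionally 1# for
  -- k = 1; a zeroth power is.
  :1 : ∀ {n} → Polynomial n → Polynomial n
  :1 u = u :^ 0

  -- With j = p - c, iterating `B-eq` down to `B-last` gives B_c = (1 + A)(1 + z + ... + z^(j-1)) +
  -- z^j A. Multiplying by 1 - z sums the geometric series without a quotient.
  B-closed : ∀ j c .{{_ : NonZero c}} → j ℕ.+ c ≡ p →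
    (1# - z) * B c ≈ (1# + A) * (1# - z ^ j) + (1# - z) * (z ^ j * A)
  B-closed zero    c refl = begin
    (1# - z) * B c ≈⟨ *-congˡ {1# - z} {B c} {A} B-last ⟩
    (1# - z) * A   ≈⟨ solve 2 (λ A z → (:1 z :- z) :* A
                       := (:1 z :+ A) :* (:1 z :- :1 z) :+ (:1 z :- z) :* (:1 z :* A)) (λ _ → refl) A z ⟩
    (1# + A) * (1# - 1#) + (1# - z) * (1# * A) ∎
  B-closed (suc j) c eq = begin
    (1# - z) * B c
      ≈⟨ *-congˡ {1# - z} {B c} (B-eq c c<p) ⟩
    (1# - z) * (1# + A + z * B (suc c))
      ≈⟨ solve 3 (λ A B z → (:1 z :- z) :* (:1 z :+ A :+ z :* B)
           := (:1 z :- z) :* (:1 z :+ A) :+ z :* ((:1 z :- z) :* B)) (λ _ → refl) A (B (suc c)) z ⟩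
    (1# - z) * (1# + A) + z * ((1# - z) * B (suc c))
      ≈⟨ +-congˡ {(1# - z) * (1# + A)} (*-congˡ {z} {(1# - z) * B (suc c)}
           (B-closed j (suc c) (trans (ℕ.+-suc j c) eq))) ⟩
    (1# - z) * (1# + A) + z * ((1# + A) * (1# - z ^ j) + (1# - z) * (z ^ j * A))
      ≈⟨ solve 3 (λ A q z → (:1 z :- z) :* (:1 z :+ A)
             :+ z :* ((:1 z :+ A) :* (:1 z :- q) :+ (:1 z :- z) :* (q :* A))
           := (:1 z :+ A) :* (:1 z :- z :* q) :+ (:1 z :- z) :* ((z :* q) :* A))
           (λ _ → refl) A (z ^ j) z ⟩
    (1# + A) * (1# - z ^ suc j) + (1# - z) * (z ^ suc j * A) ∎
    where
    c<p : c < p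
    c<p = ℕ.≤-trans (ℕ.s≤s (ℕ.m≤n+m c j)) (ℕ.≤-reflexive eq)

  -- The exponent is written `suc j` so that the power unfolds to z q with q = `z ^ j`, the power
  -- that `B-closed` produces for c = 1.
  A-closed : ∀ j → suc j ≡ p →
    A * ((1# - z) ^ 2 - z * (1# - z ^ suc j)) ≈ 1# - z ^ suc j
  A-closed j eq = begin
    A * ((1# - z) ^ 2 - z * (1# - z * q))
      -- One factor 1 - z is absorbed into A - zA, so that `A-eq` can rewrite the first A alone;
      -- then zA cancels and 1 + z B₁ remains.
      ≈⟨ solve 3 (λ A q z → A :* ((:1 z :- z) :^ 2 :- z :* (:1 z :- z :* q))
           := (:1 z :- z) :* (A :- z :* A) :- A :* z :* (:1 z :- z :* q)) (λ _ → refl) A q z ⟩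
    (1# - z) * (A - z * A) - A * z * (1# - z * q)
      ≈⟨ +-congʳ {r} (*-congˡ {1# - z} (+-congʳ { - (z * A)} A-eq)) ⟩
    (1# - z) * (1# + z * (A + B 1) - z * A) - A * z * (1# - z * q)
      ≈⟨ +-congʳ {r} (solve 3 (λ A B z → (:1 z :- z) :* (:1 z :+ z :* (A :+ B) :- z :* A)
           := (:1 z :- z) :+ z :* ((:1 z :- z) :* B)) (λ _ → refl) A (B 1) z) ⟩
    (1# - z) + z * ((1# - z) * B 1) - A * z * (1# - z * q)
      ≈⟨ +-congʳ {r} (+-congˡ {1# - z} (*-congˡ {z} (B-closed j 1 (trans (ℕ.+-comm j 1) eq)))) ⟩
    (1# - z) + z * ((1# + A) * (1# - q) + (1# - z) * (q * A)) - A * z * (1# - z * q)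
      -- Every term containing A cancels, leaving (1 - z) + z (1 - q).
      ≈⟨ solve 3 (λ A q z → (:1 z :- z) :+ z :* ((:1 z :+ A) :* (:1 z :- q) :+ (:1 z :- z) :* (q :* A))
             :- A :* z :* (:1 z :- z :* q)
           := :1 z :- z :* q) (λ _ → refl) A q z ⟩
    1# - z * q ∎
    where
    q r : Carrier
    q = z ^ j
    r = - (A * z * (1# - z * q))

-- From recurrences to the generating function.

z-*-0 : ∀ f → (z * f) 0 ≡ 0ℤ
z-*-0 f = trans (ℤ.+-identityʳ _) (ℤ.*-zeroˡ (f 0))

-- Turns a recurrence into an equation of series: e carries the initial value and the terms that are
-- not delayed by one index.
≈-shift : ∀ e f g → f 0 ≡ e 0 → (∀ n → f (suc n) ≡ e (suc n) ℤ.+ g n) → f ≈ e + z * g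
≈-shift e f g f₀ fₛ zero    =
  trans f₀ (sym (trans (cong (λ t → e 0 ℤ.+ t) (z-*-0 g)) (ℤ.+-identityʳ (e 0))))
≈-shift e f g f₀ fₛ (suc n) =
  trans (fₛ n) (cong (λ t → e (suc n) ℤ.+ t) (sym (z-* g n)))

theorem3p2 : ∀ (p : ℕ) .{{_ : NonZero p}} → Prime p →
    (λ n → + N p (suc n) (H (𝔽 p) n)) ≈ (1# - z ^ p) / ((1# - z) ^ 2 - z * (1# - z ^ p))
theorem3p2 p@(suc j) p-prime =
  ≈-/ A (1# - z ^ p) ((1# - z) ^ 2 - z * (1# - z ^ p))
    -- The denominator has constant coefficient 1: that of (1 - z)² computes to 1, and the term with
    -- the factor z contributes 0.
    (cong (λ t → 1ℤ ℤ.- t) (z-*-0 (1# - z ^ p)))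
    (Elimination.A-closed p A B A-eq B-eq (λ n → cong +_ (countLinear-p p n)) j refl)
  where
  1<p : 1 < p
  1<p = ℕ.nonTrivial⇒n>1 p {{prime⇒nonTrivial p-prime}}

  A : Carrier
  A n = + countH p n

  B : ℕ → Carrier
  B c n = + countLinear p c n

  A-eq : A ≈ 1# + z * (A + B 1)
  A-eq = ≈-shift 1# A (A + B 1) (cong +_ (countH-0 p 1<p))
    (λ n → cong +_ (trans (countH-suc p n) (ℕ.+-comm (countLinear p 1 n) (countH p n))))

  B-eq : ∀ c .{{_ : NonZero c}} → c < p → B c ≈ 1# + A + z * B (suc c)
  B-eq c c<p = ≈-shift (1# + A) (B c) (B (suc c))
    -- The initial value 2 of `countLinear` is 1 + a(0).
    (cong +_ (trans (countLinear-0 p 1<p c c<p) (cong suc (sym (countH-0 p 1<p)))))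
    (λ n → cong +_ (countLinear-suc p p-prime c c<p n))
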